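{- Let $n\ge0$ be an integer and let $Z_n$ be the number of zeros of a random lattice path $P_n$ of length $n$ (chosen according to the model in the context). Then $$\mathbb{E}(Z_n)=\frac{4}{n+1}\sum_{0\le k<\ell<\lceil n/2\rceil}\frac{\binom nk}{\binom n\ell}+[n\text{ even}]\,\frac{1}{n+1}\left(\frac{2^n}{\binom{n}{n/2}}-1\right)+1.$$
   Context: $[\mathit{expr}]$ is $1$ if $\mathit{expr}$ is true and $0$ otherwise (the term with $[n\text{ even}]$ is $0$ for odd $n$). Random path model: for an integer $n\ge0$, a random path $P_n$ on the lattice $\mathbb{Z}^2$ with steps $(1,+1)$ and $(1,-1)$, ending in $(n,0)$, is chosen as follows. First choose a starting point $(0,S)$ with $S$ uniformly distributed in $\{ -n,-n+2,\dots,n-2,n\}$. Then choose a path uniformly at random among all paths from $(0,S)$ to $(n,0)$. A zero of $P_n$ is a lattice point $(x,0)\in P_n$ visited by the path (including the starting point if $S=0$ and the end point $(n,0)$). -}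

module Defs where

open import Data.Bool using (if_then_else_)
open import Data.Fin using (Fin; toℕ)
open import Data.Fin.Properties using (toℕ<n)
open import Data.Integer as ℤ using (ℤ; +_; 0ℤ; 1ℤ; -1ℤ)
open import Data.List as List using (List; []; _∷_; _++_; length; filter; upTo)
open import Data.Nat as ℕ using (ℕ; zero; suc; NonZero; _≤_; _∸_; _!; >-nonZero; ⌊_/2⌋; ⌈_/2⌉)
open import Data.Nat.Combinatorics using (_C_; nCk≡n!/k![n-k]!; k![n∸k]!∣n!)
open import Data.Nat.Divisibility using (∣⇒≤)
open import Data.Nat.DivMod using (m≥n⇒m/n>0)
open import Data.Nat.Properties using (≤-trans; <⇒≤; ⌈n/2⌉≤n; ⌊n/2⌋≤n; _!≢0; _!*_!≢0)
open import Data.Product using (_×_; _,_)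
open import Data.Rational using (ℚ; 0ℚ; 1ℚ; _+_; _*_; _/_)
open import Data.Rational.Properties using (+-0-commutativeMonoid)
open import Data.Vec as Vec using (Vec; []; _∷_; count; last)
open import Relation.Binary.PropositionalEquality using (sym; subst)
open import Relation.Nullary using (Dec; does)

open import Algebra.Properties.CommutativeMonoid.Sum +-0-commutativeMonoid public
  using (sum-syntax)

-- Finitely supported distributions: outcomes with their probabilities.
-- An outcome may be listed several times; its probabilities then add up.
Dist : Set → Set
Dist A = List (A × ℚ)

-- Uniform distribution on the entries of a list.  The empty list, which carries
-- no uniform distribution, never arises below: from each starting height
-- - n + 2 i with i ≤ n there is a path to height 0.
uniform : {A : Set} → List A → Dist A
uniform []       = []
uniform (x ∷ xs) = List.map (λ y → y , + 1 / length (x ∷ xs)) (x ∷ xs)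

-- Two-stage experiment: draw a from d, then draw from f a.
_>>=_ : {A B : Set} → Dist A → (A → Dist B) → Dist B
d >>= f = List.concatMap (λ (a , p) → List.map (λ (b , q) → b , p * q) (f a)) d

𝔼 : {A : Set} → Dist A → (A → ℚ) → ℚ
𝔼 d X = List.foldr _+_ 0ℚ (List.map (λ (a , p) → p * X a) d)

data Step : Set where
  up down : Step

rise : Step → ℤ
rise up   = 1ℤ
rise down = -1ℤ

-- A lattice path with n steps (1 , ±1), starting at (0 , start).
record Path (n : ℕ) : Set where
  constructor path
  field
    start : ℤ
    steps : Vec Step n

heightsFrom : ∀ {n} → ℤ → Vec Step n → Vec ℤ (suc n)
heightsFrom h []       = h ∷ []
heightsFrom h (s ∷ ss) = h ∷ heightsFrom (h ℤ.+ rise s) ss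

-- The entry at index x is the y-coordinate of the path's unique point with
-- abscissa x, for 0 ≤ x ≤ n.
heights : ∀ {n} → Path n → Vec ℤ (suc n)
heights (path h ss) = heightsFrom h ss

zeros : ∀ {n} → Path n → ℕ
zeros P = count (ℤ._≟ 0ℤ) (heights P)

stepSequences : ∀ n → List (Vec Step n)
stepSequences zero    = [] ∷ []
stepSequences (suc n) =
  List.map (up ∷_) (stepSequences n) ++ List.map (down ∷_) (stepSequences n)

-- All paths from (0 , h) to (n , 0).
pathsFrom : ∀ n → ℤ → List (Path n)
pathsFrom n h =
  filter (λ P → last (heights P) ℤ.≟ 0ℤ) (List.map (path h) (stepSequences n))

-- - n , - n + 2 , … , n - 2 , n
startHeights : ℕ → List ℤ
startHeights n = List.map (λ i → ℤ.- (+ n) ℤ.+ + (2 ℕ.* i)) (upTo (suc n))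

randomPath : ∀ n → Dist (Path n)
randomPath n = uniform (startHeights n) >>= λ S → uniform (pathsFrom n S)

fromℕ : ℕ → ℚ
fromℕ m = + m / 1

-- Iverson bracket.
[[_]] : {P : Set} → Dec P → ℚ
[[ P? ]] = if does P? then 1ℚ else 0ℚ

nCk≢0 : ∀ {n k} → k ≤ n → NonZero (n C k)
nCk≢0 {n} {k} k≤n = subst NonZero (sym (nCk≡n!/k![n-k]! k≤n))
  (>-nonZero (m≥n⇒m/n>0 {{k !* (n ∸ k) !≢0}} (∣⇒≤ {{n !≢0}} (k![n∸k]!∣n! k≤n))))

nCℓ≢0 : ∀ n (ℓ : Fin ⌈ n /2⌉) → NonZero (n C toℕ ℓ)
nCℓ≢0 n ℓ = nCk≢0 (≤-trans (<⇒≤ (toℕ<n ℓ)) (⌈n/2⌉≤n n))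

nC⌊n/2⌋≢0 : ∀ n → NonZero (n C ⌊ n /2⌋)
nC⌊n/2⌋≢0 n = nCk≢0 (⌊n/2⌋≤n n)

{-# OPTIONS --safe #-}
module Submission where

-- Classify the paths by their numbers a of down-steps and b of up-steps, with
-- a + b = n.  There are C(n,a) of them, and together they have
-- C(n,a) + 2 ∑_{k < min(a,b)} C(n,k) zeros: removing the first step, both
-- sides satisfy the same recursion, which is Pascal's rule except for the
-- extra C(n,a) on the diagonal a = b.  Hence
-- (n+1) 𝔼(Z) = ∑_a (1 + 2 ∑_{k < min(a,n-a)} C(n,k) / C(n,a)); folding this sum
-- by a ↔ n - a counts each a < n/2 twice, and the middle term for even n is
-- evaluated with 2^n = C(n,n/2) + 2 ∑_{k < n/2} C(n,k).

open import Defs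
open import Data.Bool using (true; false; if_then_else_)
open import Data.Fin using (toℕ)
open import Data.Integer as ℤ using (ℤ; +_; -[1+_]; 0ℤ; 1ℤ; -1ℤ; _⊖_)
import Data.Integer.Properties as ℤ
import Data.Integer.Tactic.RingSolver as ℤ
open import Data.List as List using (List; []; _∷_; _++_; length; filter; applyUpTo; upTo)
open import Data.List.Properties using (filter-++; filter-≐; length-++; length-map; length-upTo; map-++; map-∘; map-cong; map-upTo)
open import Data.Nat as ℕ using (ℕ; zero; suc; NonZero; _^_; _∸_; _⊓_; _≤_; _<_; s≤s; s≤s⁻¹; ⌊_/2⌋; ⌈_/2⌉)
open import Data.Nat.Combinatorics using (_C_; nCn≡1; k>n⇒nCk≡0; nCk≡nC[n∸k]; nCk+nC[k+1]≡[n+1]C[k+1])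
open import Data.Nat.Divisibility using (_∣_; _∣?_; _∣0; >⇒∤; ∣m∣n⇒∣m+n; ∣m+n∣m⇒∣n; ∣-refl)
open import Data.Nat.ListAction using (sum)
open import Data.Nat.ListAction.Properties using (sum-++)
import Data.Nat.Properties as ℕ
import Data.Nat.Tactic.RingSolver as ℕ
open import Data.Product using (_×_; _,_)
open import Data.Sum using (_⊎_; inj₁; inj₂)
open import Data.Vec using (Vec; []; _∷_; last)
open import Function using (_∘_)
open import Relation.Binary.Definitions using (tri<; tri≈; tri>)
open import Relation.Binary.PropositionalEquality
open import Relation.Nullary using (¬_; Dec; does; contradiction)
open import Relation.Nullary.Decidable using (dec-true; dec-false)
open import Relation.Unary using (Decidable)
open ≡-Reasoning

module Bridges where

  open import Data.Integer.Properties using (n⊖n≡0; [1+m]⊖[1+n]≡m⊖n; distribˡ-⊖-+-pos; distribˡ-⊖-+-neg)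
  open import Data.Nat using (_+_; _*_)
  open import Data.Nat.Properties using (n<1+n; n≤1+n; <⇒≢; *-zeroʳ; ⊓-zeroʳ; +-comm; +-suc; +-identityʳ; suc-injective; m≤m+n; m+n∸m≡n;
    <-cmp; m≤n⇒m⊓n≡m; m≥n⇒m⊓n≡n; ⊓-idem; <⇒≤; m≤n⇒m≤1+n)
  open import Data.Nat.Tactic.RingSolver using (solve-∀)

  -- Binomial coefficients and partial sums of the rows of Pascal's triangle.

  [a+b]Ca≡[a+b]Cb : ∀ a b → (a + b) C a ≡ (a + b) C b
  [a+b]Ca≡[a+b]Cb a b = trans (nCk≡nC[n∸k] (m≤m+n a b)) (cong ((a + b) C_) (m+n∸m≡n a b))

  ∑C : ℕ → ℕ → ℕ
  ∑C n zero    = 0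
  ∑C n (suc m) = ∑C n m + n C m

  -- Pascal's rule summed over k ≤ m. The second sum on the right is one term shorter because
  -- C(n+1,0) has only one parent in row n.
  ∑C-suc : ∀ n m → ∑C (suc n) (suc m) ≡ ∑C n (suc m) + ∑C n m
  ∑C-suc n zero    = refl
  ∑C-suc n (suc m) = begin
    ∑C (suc n) (suc m) + suc n C suc m
      ≡⟨ cong₂ _+_ (∑C-suc n m) (sym (nCk+nC[k+1]≡[n+1]C[k+1] n m)) ⟩
    (∑C n m + n C m + ∑C n m) + (n C m + n C suc m)
      ≡⟨ regroup (∑C n m) (n C m) (n C suc m) ⟩
    (∑C n m + n C m + n C suc m) + (∑C n m + n C m) ∎
    where
    regroup : ∀ s x y → (s + x + s) + (x + y) ≡ (s + x + y) + (s + x)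
    regroup = solve-∀

  ∑C-full : ∀ n → ∑C n (suc n) ≡ 2 ^ n
  ∑C-full zero    = refl
  ∑C-full (suc n) = begin
    ∑C (suc n) (suc (suc n))                 ≡⟨ ∑C-suc n (suc n) ⟩
    ∑C n (suc n) + n C suc n + ∑C n (suc n)  ≡⟨ cong (λ c → ∑C n (suc n) + c + ∑C n (suc n)) (k>n⇒nCk≡0 (n<1+n n)) ⟩
    ∑C n (suc n) + 0 + ∑C n (suc n)          ≡⟨ double (∑C n (suc n)) ⟩
    2 * ∑C n (suc n)                         ≡⟨ cong (2 *_) (∑C-full n) ⟩
    2 ^ suc n                                ∎
    where
    double : ∀ s → s + 0 + s ≡ 2 * s
    double = solve-∀

  -- Under k ↔ n - k the indices k < b become the indices from a to n, so the two sums together fill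
  -- row n. The induction uses no reflection: `∑C-suc` splits both sums, and exchanging partners
  -- yields two instances in the previous row, (a+1, b) and (a, b+1).
  ∑C-complement : ∀ n a b → a + b ≡ suc n → ∑C n a + ∑C n b ≡ 2 ^ n
  ∑C-complement n       zero    b       refl = ∑C-full n
  ∑C-complement n       (suc a) zero    eq   = begin
    ∑C n (suc a) + 0  ≡⟨ +-identityʳ _ ⟩
    ∑C n (suc a)      ≡⟨ cong (∑C n) (trans (sym (+-identityʳ (suc a))) eq) ⟩
    ∑C n (suc n)      ≡⟨ ∑C-full n ⟩
    2 ^ n             ∎
  ∑C-complement zero    (suc a) (suc b) eq   = contradiction (trans (sym (+-suc a b)) (suc-injective eq)) λ ()
  ∑C-complement (suc n) (suc a) (suc b) eq   = begin
    ∑C (suc n) (suc a) + ∑C (suc n) (suc b)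
      ≡⟨ cong₂ _+_ (∑C-suc n a) (∑C-suc n b) ⟩
    (∑C n (suc a) + ∑C n a) + (∑C n (suc b) + ∑C n b)
      ≡⟨ regroup (∑C n (suc a)) (∑C n a) (∑C n (suc b)) (∑C n b) ⟩
    (∑C n (suc a) + ∑C n b) + (∑C n a + ∑C n (suc b))
      ≡⟨ cong₂ _+_ (∑C-complement n (suc a) b (trans (sym (+-suc a b)) (suc-injective eq)))
                   (∑C-complement n a (suc b) (suc-injective eq)) ⟩
    2 ^ n + 2 ^ n
      ≡⟨ cong₂ _+_ refl (+-identityʳ (2 ^ n)) ⟨
    2 ^ suc n ∎
    where
    regroup : ∀ w x y z → (w + x) + (y + z) ≡ (w + z) + (x + y)
    regroup = solve-∀

  -- Bridges, that is, step sequences leading from a given height to 0, and their decomposition by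
  -- the first step.

  filter-map : {A B : Set} {P : B → Set} (P? : Decidable P) (f : A → B) (xs : List A) →
               filter P? (List.map f xs) ≡ List.map f (filter (P? ∘ f) xs)
  filter-map P? f []       = refl
  filter-map P? f (x ∷ xs) with does (P? (f x))
  ... | true  = cong (f x ∷_) (filter-map P? f xs)
  ... | false = filter-map P? f xs

  sum-map-+ : {A : Set} (c : ℕ) (f : A → ℕ) (xs : List A) →
              sum (List.map (λ x → c + f x) xs) ≡ c * length xs + sum (List.map f xs)
  sum-map-+ c f []       = sym (trans (+-identityʳ (c * 0)) (*-zeroʳ c))
  sum-map-+ c f (x ∷ xs) = trans (cong₂ _+_ refl (sum-map-+ c f xs))
                                 (regroup c (f x) (length xs) (sum (List.map f xs)))
    where
    regroup : ∀ c y l s → (c + y) + (c * l + s) ≡ c * suc l + (y + s)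
    regroup = solve-∀

  -- The paths of `pathsFrom` without their start height: removing the first step of a bridge from h
  -- leaves a bridge from a neighbouring height, which allows induction on n.
  bridges : ∀ n → ℤ → List (Vec Step n)
  bridges n h = filter (λ ss → last (heightsFrom h ss) ℤ.≟ 0ℤ) (stepSequences n)

  pathsFrom≡map-bridges : ∀ n h → pathsFrom n h ≡ List.map (path h) (bridges n h)
  pathsFrom≡map-bridges n h = filter-map (λ P → last (heights P) ℤ.≟ 0ℤ) (path h) (stepSequences n)

  last-heightsFrom : ∀ {n} h s (ss : Vec Step n) →
                     last (heightsFrom h (s ∷ ss)) ≡ last (heightsFrom (h ℤ.+ rise s) ss)
  last-heightsFrom h s []      = refl
  last-heightsFrom h s (_ ∷ _) = refl

  bridges-suc : ∀ n h → bridges (suc n) h ≡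
                List.map (up ∷_) (bridges n (h ℤ.+ 1ℤ)) ++ List.map (down ∷_) (bridges n (h ℤ.+ -1ℤ))
  bridges-suc n h = begin
    bridges (suc n) h
      ≡⟨ filter-++ endsAt0? (List.map (up ∷_) (stepSequences n)) _ ⟩
    filter endsAt0? (List.map (up ∷_) (stepSequences n)) ++ filter endsAt0? (List.map (down ∷_) (stepSequences n))
      ≡⟨ cong₂ _++_ (first up) (first down) ⟩
    List.map (up ∷_) (bridges n (h ℤ.+ 1ℤ)) ++ List.map (down ∷_) (bridges n (h ℤ.+ -1ℤ)) ∎
    where
    endsAt0? : Decidable (λ (ss : Vec Step (suc n)) → last (heightsFrom h ss) ≡ 0ℤ)
    endsAt0? ss = last (heightsFrom h ss) ℤ.≟ 0ℤ

    first : ∀ s → filter endsAt0? (List.map (s ∷_) (stepSequences n)) ≡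
                  List.map (s ∷_) (bridges n (h ℤ.+ rise s))
    first s = trans (filter-map endsAt0? (s ∷_) (stepSequences n))
      (cong (List.map (s ∷_)) (filter-≐ (endsAt0? ∘ (s ∷_)) (λ ss → last (heightsFrom (h ℤ.+ rise s) ss) ℤ.≟ 0ℤ)
        ( (λ {ss} → trans (sym (last-heightsFrom h s ss)))
        , (λ {ss} → trans (last-heightsFrom h s ss))) (stepSequences n)))

  -- First-step recursions for the number of bridges and the total number of their zeros.

  #bridges : ℕ → ℤ → ℕ
  #bridges n h = length (bridges n h)

  #zeros : ℕ → ℤ → ℕ
  #zeros n h = sum (List.map (zeros ∘ path h) (bridges n h))

  isZero : ℤ → ℕ
  isZero h = if does (h ℤ.≟ 0ℤ) then 1 else 0

  zeros-∷ : ∀ {n} h s (ss : Vec Step n) →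
            zeros (path h (s ∷ ss)) ≡ isZero h + zeros (path (h ℤ.+ rise s) ss)
  zeros-∷ h s ss with does (h ℤ.≟ 0ℤ)
  ... | true  = refl
  ... | false = refl

  #bridges-suc : ∀ n h → #bridges (suc n) h ≡ #bridges n (h ℤ.+ 1ℤ) + #bridges n (h ℤ.+ -1ℤ)
  #bridges-suc n h = begin
    length (bridges (suc n) h)
      ≡⟨ cong length (bridges-suc n h) ⟩
    length (List.map (up ∷_) (bridges n (h ℤ.+ 1ℤ)) ++ List.map (down ∷_) (bridges n (h ℤ.+ -1ℤ)))
      ≡⟨ length-++ (List.map (up ∷_) (bridges n (h ℤ.+ 1ℤ))) ⟩
    length (List.map (up ∷_) (bridges n (h ℤ.+ 1ℤ))) + length (List.map (down ∷_) (bridges n (h ℤ.+ -1ℤ)))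
      ≡⟨ cong₂ _+_ (length-map (up ∷_) (bridges n (h ℤ.+ 1ℤ))) (length-map (down ∷_) (bridges n (h ℤ.+ -1ℤ))) ⟩
    #bridges n (h ℤ.+ 1ℤ) + #bridges n (h ℤ.+ -1ℤ) ∎

  -- The starting point is a zero of every bridge if h = 0 and of none otherwise; all other zeros
  -- belong to the shorter bridge left after the first step.
  #zeros-suc : ∀ n h → #zeros (suc n) h ≡
               isZero h * #bridges (suc n) h + (#zeros n (h ℤ.+ 1ℤ) + #zeros n (h ℤ.+ -1ℤ))
  #zeros-suc n h = begin
    sum (List.map z (bridges (suc n) h))
      ≡⟨ cong (sum ∘ List.map z) (bridges-suc n h) ⟩
    sum (List.map z (ups ++ downs))
      ≡⟨ cong sum (map-++ z ups downs) ⟩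
    sum (List.map z ups ++ List.map z downs)
      ≡⟨ sum-++ (List.map z ups) (List.map z downs) ⟩
    sum (List.map z ups) + sum (List.map z downs)
      ≡⟨ cong₂ _+_ (first up) (first down) ⟩
    (isZero h * #bridges n (h ℤ.+ 1ℤ) + #zeros n (h ℤ.+ 1ℤ)) + (isZero h * #bridges n (h ℤ.+ -1ℤ) + #zeros n (h ℤ.+ -1ℤ))
      ≡⟨ regroup (isZero h) (#bridges n (h ℤ.+ 1ℤ)) (#zeros n (h ℤ.+ 1ℤ)) (#bridges n (h ℤ.+ -1ℤ)) (#zeros n (h ℤ.+ -1ℤ)) ⟩
    isZero h * (#bridges n (h ℤ.+ 1ℤ) + #bridges n (h ℤ.+ -1ℤ)) + (#zeros n (h ℤ.+ 1ℤ) + #zeros n (h ℤ.+ -1ℤ))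
      ≡⟨ cong (λ b → isZero h * b + (#zeros n (h ℤ.+ 1ℤ) + #zeros n (h ℤ.+ -1ℤ))) (#bridges-suc n h) ⟨
    isZero h * #bridges (suc n) h + (#zeros n (h ℤ.+ 1ℤ) + #zeros n (h ℤ.+ -1ℤ)) ∎
    where
    z : Vec Step (suc n) → ℕ
    z = zeros ∘ path h

    ups downs : List (Vec Step (suc n))
    ups   = List.map (up ∷_) (bridges n (h ℤ.+ 1ℤ))
    downs = List.map (down ∷_) (bridges n (h ℤ.+ -1ℤ))

    first : ∀ s → sum (List.map z (List.map (s ∷_) (bridges n (h ℤ.+ rise s)))) ≡
                  isZero h * #bridges n (h ℤ.+ rise s) + #zeros n (h ℤ.+ rise s)
    first s = begin
      sum (List.map z (List.map (s ∷_) bs))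
        ≡⟨ cong sum (map-∘ bs) ⟨
      sum (List.map (z ∘ (s ∷_)) bs)
        ≡⟨ cong sum (map-cong (zeros-∷ h s) bs) ⟩
      sum (List.map (λ ss → isZero h + zeros (path (h ℤ.+ rise s) ss)) bs)
        ≡⟨ sum-map-+ (isZero h) (zeros ∘ path (h ℤ.+ rise s)) bs ⟩
      isZero h * #bridges n (h ℤ.+ rise s) + #zeros n (h ℤ.+ rise s) ∎
      where bs = bridges n (h ℤ.+ rise s)

    regroup : ∀ c p q r s → (c * p + q) + (c * r + s) ≡ c * (p + r) + (q + s)
    regroup = solve-∀

  -- From a height above n, n steps cannot come down to 0. The surplus `k` stays arbitrary because
  -- after an up-step it becomes 2 + k relative to the n steps left.
  #bridges-above : ∀ n k → #bridges n (+ suc (n + k)) ≡ 0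
  #bridges-above zero    k = refl
  #bridges-above (suc n) k = begin
    #bridges (suc n) (+ suc (suc n + k))
      ≡⟨ #bridges-suc n (+ suc (suc n + k)) ⟩
    #bridges n (+ suc (suc n + k + 1)) + #bridges n (+ suc (n + k))
      ≡⟨ cong₂ (λ i j → #bridges n (+ suc i) + j) (shift n k) (#bridges-above n k) ⟩
    #bridges n (+ suc (n + (2 + k))) + 0
      ≡⟨ cong (_+ 0) (#bridges-above n (2 + k)) ⟩
    0 ∎
    where
    shift : ∀ n k → suc n + k + 1 ≡ n + (2 + k)
    shift = solve-∀

  #bridges-below : ∀ n k → #bridges n -[1+ n + k ] ≡ 0
  #bridges-below zero    k = refl
  #bridges-below (suc n) k = begin
    #bridges (suc n) -[1+ suc n + k ]
      ≡⟨ #bridges-suc n -[1+ suc n + k ] ⟩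
    #bridges n -[1+ n + k ] + #bridges n -[1+ suc (suc n + k + 0) ]
      ≡⟨ cong₂ (λ j i → j + #bridges n -[1+ i ]) (#bridges-below n k) (shift n k) ⟩
    #bridges n -[1+ n + (2 + k) ]
      ≡⟨ #bridges-below n (2 + k) ⟩
    0 ∎
    where
    shift : ∀ n k → suc (suc n + k + 0) ≡ n + (2 + k)
    shift = solve-∀

  #bridges≡0⇒#zeros≡0 : ∀ n h → #bridges n h ≡ 0 → #zeros n h ≡ 0
  #bridges≡0⇒#zeros≡0 n h eq with bridges n h
  ... | [] = refl

  -- Closed forms in terms of the numbers a of down-steps and b of up-steps.

  ⊖-up : ∀ a b → (a ⊖ suc b) ℤ.+ 1ℤ ≡ a ⊖ b
  ⊖-up a b = begin
    (a ⊖ suc b) ℤ.+ 1ℤ  ≡⟨ distribˡ-⊖-+-pos 1 a (suc b) ⟩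
    (a + 1) ⊖ suc b     ≡⟨ cong (_⊖ suc b) (+-comm a 1) ⟩
    suc a ⊖ suc b       ≡⟨ [1+m]⊖[1+n]≡m⊖n a b ⟩
    a ⊖ b               ∎

  -- With start heights written as a ⊖ b, taking a down-step uses up one of the down-steps to come,
  -- just as in `⊖-up` an up-step uses up one of the up-steps.
  ⊖-down : ∀ a b → (suc a ⊖ b) ℤ.+ -1ℤ ≡ a ⊖ b
  ⊖-down a b = begin
    (suc a ⊖ b) ℤ.+ -1ℤ  ≡⟨ distribˡ-⊖-+-neg 0 (suc a) b ⟩
    suc a ⊖ suc (b + 0)  ≡⟨ cong (λ c → suc a ⊖ suc c) (+-identityʳ b) ⟩
    suc a ⊖ suc b        ≡⟨ [1+m]⊖[1+n]≡m⊖n a b ⟩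
    a ⊖ b                ∎

  isZero-⊖-≡ : ∀ a → isZero (a ⊖ a) ≡ 1
  isZero-⊖-≡ a = cong (λ b → if b then 1 else 0) (dec-true ((a ⊖ a) ℤ.≟ 0ℤ) (n⊖n≡0 a))

  isZero-⊖-≢ : ∀ {a b} → a ≢ b → isZero (a ⊖ b) ≡ 0
  isZero-⊖-≢ {a} {b} a≢b = cong (λ b → if b then 1 else 0)
    (dec-false ((a ⊖ b) ℤ.≟ 0ℤ) λ a⊖b≡0 → a≢b (ℤ.+-injective (ℤ.i-j≡0⇒i≡j (+ a) (+ b) (trans (ℤ.m-n≡m⊖n a b) a⊖b≡0))))

  -- A bridge with a down-steps and b up-steps starts at height a ⊖ b.
  #bridges-⊖ : ∀ n a b → a + b ≡ n → #bridges n (a ⊖ b) ≡ n C a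
  #bridges-⊖ zero    zero    zero    refl = refl
  #bridges-⊖ (suc n) zero    (suc b) refl = begin
    #bridges (suc b) (0 ⊖ suc b)
      ≡⟨ #bridges-suc b (0 ⊖ suc b) ⟩
    #bridges b ((0 ⊖ suc b) ℤ.+ 1ℤ) + #bridges b -[1+ suc (b + 0) ]
      ≡⟨ cong₂ (λ h i → #bridges b h + #bridges b -[1+ i ]) (⊖-up 0 b) (sym (+-suc b 0)) ⟩
    #bridges b (0 ⊖ b) + #bridges b -[1+ b + 1 ]
      -- A down-step would lead to height -(b+2), too low for the b remaining steps, so only the
      -- path of up-steps survives.
      ≡⟨ cong₂ _+_ (#bridges-⊖ b 0 b refl) (#bridges-below b 1) ⟩
    suc b C 0 ∎
  #bridges-⊖ (suc n) (suc a) zero    eq = begin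
    #bridges (suc n) (+ suc a)
      ≡⟨ cong (λ i → #bridges (suc n) (+ i)) 1+a≡1+n ⟩
    #bridges (suc n) (+ suc n)
      ≡⟨ #bridges-suc n (+ suc n) ⟩
    #bridges n (+ suc (n + 1)) + #bridges n (n ⊖ 0)
      ≡⟨ cong₂ _+_ (#bridges-above n 1) (#bridges-⊖ n n 0 (+-identityʳ n)) ⟩
    n C n
      ≡⟨ nCn≡1 n ⟩
    1
      ≡⟨ nCn≡1 (suc n) ⟨
    suc n C suc n
      ≡⟨ cong (suc n C_) 1+a≡1+n ⟨
    suc n C suc a ∎
    where
    1+a≡1+n : suc a ≡ suc n
    1+a≡1+n = trans (sym (+-identityʳ (suc a))) eq
  #bridges-⊖ (suc n) (suc a) (suc b) eq = begin
    #bridges (suc n) (suc a ⊖ suc b)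
      ≡⟨ #bridges-suc n (suc a ⊖ suc b) ⟩
    #bridges n ((suc a ⊖ suc b) ℤ.+ 1ℤ) + #bridges n ((suc a ⊖ suc b) ℤ.+ -1ℤ)
      ≡⟨ cong₂ (λ h k → #bridges n h + #bridges n k) (⊖-up (suc a) b) (⊖-down a (suc b)) ⟩
    #bridges n (suc a ⊖ b) + #bridges n (a ⊖ suc b)
      ≡⟨ cong₂ _+_ (#bridges-⊖ n (suc a) b (trans (sym (+-suc a b)) (suc-injective eq)))
                   (#bridges-⊖ n a (suc b) (suc-injective eq)) ⟩
    n C suc a + n C a
      ≡⟨ +-comm (n C suc a) (n C a) ⟩
    n C a + n C suc a
      ≡⟨ nCk+nC[k+1]≡[n+1]C[k+1] n a ⟩
    suc n C suc a ∎

  -- The first summand counts the end point, a zero of each of the C(n,a) bridges; the second counts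
  -- all earlier zeros.
  zeroCount : ℕ → ℕ → ℕ → ℕ
  zeroCount n a b = n C a + 2 * ∑C n (a ⊓ b)

  -- Off the diagonal the two minima on the left are consecutive, and `∑C-suc` applies directly. On
  -- the diagonal both equal a, and the sum lacks 2 C(n,a), which is exactly the contribution
  -- C(n+1,a+1) of the starting points.
  zeroCount-suc : ∀ n a b → a + suc b ≡ n → isZero (suc a ⊖ suc b) * (suc n C suc a)
                  + (zeroCount n (suc a) b + zeroCount n a (suc b)) ≡ zeroCount (suc n) (suc a) (suc b)
  zeroCount-suc n a b eq = begin
    isZero (suc a ⊖ suc b) * (suc n C suc a) + (zeroCount n (suc a) b + zeroCount n a (suc b))
      ≡⟨ regroup (isZero (suc a ⊖ suc b) * (suc n C suc a)) (n C suc a) (n C a) (∑C n (suc a ⊓ b)) (∑C n (a ⊓ suc b)) ⟩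
    n C a + n C suc a
      + (isZero (suc a ⊖ suc b) * (suc n C suc a) + 2 * (∑C n (suc a ⊓ b) + ∑C n (a ⊓ suc b)))
      ≡⟨ cong₂ _+_ (nCk+nC[k+1]≡[n+1]C[k+1] n a) sums ⟩
    zeroCount (suc n) (suc a) (suc b) ∎
    where
    regroup : ∀ i x y s t → i + ((x + 2 * s) + (y + 2 * t)) ≡ y + x + (i + 2 * (s + t))
    regroup = solve-∀

    sums : isZero (suc a ⊖ suc b) * (suc n C suc a) + 2 * (∑C n (suc a ⊓ b) + ∑C n (a ⊓ suc b))
           ≡ 2 * ∑C (suc n) (suc (a ⊓ b))
    sums with <-cmp a b
    ... | tri< a<b _ _ = begin
      isZero (suc a ⊖ suc b) * (suc n C suc a) + 2 * (∑C n (suc a ⊓ b) + ∑C n (a ⊓ suc b))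
        ≡⟨ cong₂ _+_ (cong (_* (suc n C suc a)) (isZero-⊖-≢ (<⇒≢ (s≤s a<b))))
             (cong₂ (λ i j → 2 * (∑C n i + ∑C n j)) (m≤n⇒m⊓n≡m a<b) (m≤n⇒m⊓n≡m (m≤n⇒m≤1+n (<⇒≤ a<b)))) ⟩
      2 * (∑C n (suc a) + ∑C n a)
        ≡⟨ cong (2 *_) (∑C-suc n a) ⟨
      2 * ∑C (suc n) (suc a)
        ≡⟨ cong (λ i → 2 * ∑C (suc n) (suc i)) (m≤n⇒m⊓n≡m (<⇒≤ a<b)) ⟨
      2 * ∑C (suc n) (suc (a ⊓ b)) ∎
    ... | tri> _ _ b<a = begin
      isZero (suc a ⊖ suc b) * (suc n C suc a) + 2 * (∑C n (suc a ⊓ b) + ∑C n (a ⊓ suc b))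
        ≡⟨ cong₂ _+_ (cong (_* (suc n C suc a)) (isZero-⊖-≢ (≢-sym (<⇒≢ (s≤s b<a)))))
             (cong₂ (λ i j → 2 * (∑C n i + ∑C n j)) (m≥n⇒m⊓n≡n (m≤n⇒m≤1+n (<⇒≤ b<a))) (m≥n⇒m⊓n≡n b<a)) ⟩
      2 * (∑C n b + ∑C n (suc b))
        ≡⟨ cong (2 *_) (+-comm (∑C n b) (∑C n (suc b))) ⟩
      2 * (∑C n (suc b) + ∑C n b)
        ≡⟨ cong (2 *_) (∑C-suc n b) ⟨
      2 * ∑C (suc n) (suc b)
        ≡⟨ cong (λ i → 2 * ∑C (suc n) (suc i)) (m≥n⇒m⊓n≡n (<⇒≤ b<a)) ⟨
      2 * ∑C (suc n) (suc (a ⊓ b)) ∎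
    ... | tri≈ _ refl _ = begin
      isZero (suc a ⊖ suc a) * (suc n C suc a) + 2 * (∑C n (suc a ⊓ a) + ∑C n (a ⊓ suc a))
        ≡⟨ cong₂ _+_ (cong₂ _*_ (isZero-⊖-≡ (suc a)) central)
             (cong₂ (λ i j → 2 * (∑C n i + ∑C n j)) (m≥n⇒m⊓n≡n (n≤1+n a)) (m≤n⇒m⊓n≡m (n≤1+n a))) ⟩
      1 * (n C a + n C a) + 2 * (∑C n a + ∑C n a)
        ≡⟨ regroup′ (n C a) (∑C n a) ⟩
      2 * (∑C n (suc a) + ∑C n a)
        ≡⟨ cong (2 *_) (∑C-suc n a) ⟨
      2 * ∑C (suc n) (suc a)
        ≡⟨ cong (λ i → 2 * ∑C (suc n) (suc i)) (⊓-idem a) ⟨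
      2 * ∑C (suc n) (suc (a ⊓ a)) ∎
      where
      -- Here n = 2a + 1, so C(n,a) and C(n,a+1) are the two equal middle entries of row n.
      central : suc n C suc a ≡ n C a + n C a
      central = trans (sym (nCk+nC[k+1]≡[n+1]C[k+1] n a))
        (cong₂ _+_ refl (subst (λ n → n C suc a ≡ n C a) eq (sym ([a+b]Ca≡[a+b]Cb a (suc a)))))

      regroup′ : ∀ c s → 1 * (c + c) + 2 * (s + s) ≡ 2 * ((s + c) + s)
      regroup′ = solve-∀

  -- Induction matching `#zeros-suc` with `zeroCount-suc`. If n > 0 and all steps are of one kind,
  -- the only zero is the end point, since the other first step leads out of reach of 0.
  #zeros-⊖ : ∀ n a b → a + b ≡ n → #zeros n (a ⊖ b) ≡ zeroCount n a b
  #zeros-⊖ zero    zero    zero    refl = refl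
  #zeros-⊖ (suc n) zero    (suc b) refl = begin
    #zeros (suc b) (0 ⊖ suc b)
      ≡⟨ #zeros-suc b (0 ⊖ suc b) ⟩
    #zeros b ((0 ⊖ suc b) ℤ.+ 1ℤ) + #zeros b -[1+ suc (b + 0) ]
      ≡⟨ cong₂ (λ h i → #zeros b h + #zeros b -[1+ i ]) (⊖-up 0 b) (sym (+-suc b 0)) ⟩
    #zeros b (0 ⊖ b) + #zeros b -[1+ b + 1 ]
      ≡⟨ cong₂ _+_ (#zeros-⊖ b 0 b refl) (#bridges≡0⇒#zeros≡0 b -[1+ b + 1 ] (#bridges-below b 1)) ⟩
    zeroCount (suc b) 0 (suc b) ∎
  #zeros-⊖ (suc n) (suc a) zero    eq = begin
    #zeros (suc n) (+ suc a)
      ≡⟨ cong (λ i → #zeros (suc n) (+ i)) 1+a≡1+n ⟩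
    #zeros (suc n) (+ suc n)
      ≡⟨ #zeros-suc n (+ suc n) ⟩
    #zeros n (+ suc (n + 1)) + #zeros n (n ⊖ 0)
      ≡⟨ cong₂ _+_ (#bridges≡0⇒#zeros≡0 n (+ suc (n + 1)) (#bridges-above n 1)) (#zeros-⊖ n n 0 (+-identityʳ n)) ⟩
    n C n + 2 * ∑C n (n ⊓ 0)
      ≡⟨ cong₂ (λ c m → c + 2 * ∑C n m) (trans (nCn≡1 n) (sym (nCn≡1 (suc n)))) (⊓-zeroʳ n) ⟩
    suc n C suc n + 0
      ≡⟨ cong (λ i → suc n C i + 0) 1+a≡1+n ⟨
    zeroCount (suc n) (suc a) 0 ∎
    where
    1+a≡1+n : suc a ≡ suc n
    1+a≡1+n = trans (sym (+-identityʳ (suc a))) eq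
  #zeros-⊖ (suc n) (suc a) (suc b) eq = begin
    #zeros (suc n) (suc a ⊖ suc b)
      ≡⟨ #zeros-suc n (suc a ⊖ suc b) ⟩
    isZero (suc a ⊖ suc b) * #bridges (suc n) (suc a ⊖ suc b)
      + (#zeros n ((suc a ⊖ suc b) ℤ.+ 1ℤ) + #zeros n ((suc a ⊖ suc b) ℤ.+ -1ℤ))
      ≡⟨ cong₂ (λ h k → isZero (suc a ⊖ suc b) * #bridges (suc n) (suc a ⊖ suc b) + (#zeros n h + #zeros n k))
           (⊖-up (suc a) b) (⊖-down a (suc b)) ⟩
    isZero (suc a ⊖ suc b) * #bridges (suc n) (suc a ⊖ suc b) + (#zeros n (suc a ⊖ b) + #zeros n (a ⊖ suc b))
      ≡⟨ cong₂ (λ c z → isZero (suc a ⊖ suc b) * c + z) (#bridges-⊖ (suc n) (suc a) (suc b) eq)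
           (cong₂ _+_ (#zeros-⊖ n (suc a) b (trans (sym (+-suc a b)) (suc-injective eq)))
                      (#zeros-⊖ n a (suc b) (suc-injective eq))) ⟩
    isZero (suc a ⊖ suc b) * (suc n C suc a) + (zeroCount n (suc a) b + zeroCount n a (suc b))
      ≡⟨ zeroCount-suc n a b (suc-injective eq) ⟩
    zeroCount (suc n) (suc a) (suc b) ∎

open Bridges

open import Data.Rational using (ℚ; 0ℚ; 1ℚ; _+_; _-_; _*_; _/_; fromℚᵘ)
open import Data.Rational.Properties
open import Data.Rational.Solver using (module +-*-Solver)
open import Data.Rational.Unnormalised as ℚᵘ using (mkℚᵘ; *≡*)
import Data.Rational.Unnormalised.Properties as ℚᵘ
open import Algebra.Properties.CommutativeMonoid.Sum +-0-commutativeMonoid using (sum-cong-≗)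

-- Fractions of natural numbers.

infixl 7 _÷_

-- Division of naturals as a total operation, with m ÷ 0 = 0.
_÷_ : ℕ → ℕ → ℚ
m ÷ zero  = 0ℚ
m ÷ suc d = + m / suc d

-- Connects the fractions of the theorem with `_÷_`, whose divisor can be rewritten without
-- transporting a proof that it is nonzero.
/≡÷ : ∀ m d .{{_ : NonZero d}} → + m / d ≡ m ÷ d
/≡÷ m zero {{d≢0}} = contradiction refl (ℕ.≢-nonZero⁻¹ 0 {{d≢0}})
/≡÷ m (suc d) = refl

-- Identities between fractions are checked by cross-multiplication on unnormalised rationals; this
-- and its multiplicative analogue carry the results over to ℚ.
fromℚᵘ-homo-+ : ∀ p q → fromℚᵘ (p ℚᵘ.+ q) ≡ fromℚᵘ p + fromℚᵘ q
fromℚᵘ-homo-+ p q = toℚᵘ-injective (ℚᵘ.≃-trans (toℚᵘ-fromℚᵘ (p ℚᵘ.+ q))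
  (ℚᵘ.≃-sym (ℚᵘ.≃-trans (toℚᵘ-homo-+ (fromℚᵘ p) (fromℚᵘ q)) (ℚᵘ.+-cong (toℚᵘ-fromℚᵘ p) (toℚᵘ-fromℚᵘ q)))))

fromℚᵘ-homo-* : ∀ p q → fromℚᵘ (p ℚᵘ.* q) ≡ fromℚᵘ p * fromℚᵘ q
fromℚᵘ-homo-* p q = toℚᵘ-injective (ℚᵘ.≃-trans (toℚᵘ-fromℚᵘ (p ℚᵘ.* q))
  (ℚᵘ.≃-sym (ℚᵘ.≃-trans (toℚᵘ-homo-* (fromℚᵘ p) (fromℚᵘ q)) (ℚᵘ.*-cong (toℚᵘ-fromℚᵘ p) (toℚᵘ-fromℚᵘ q)))))

÷-distribʳ-+ : ∀ d m n → (m ℕ.+ n) ÷ d ≡ m ÷ d + n ÷ d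
÷-distribʳ-+ zero    m n = refl
÷-distribʳ-+ (suc d) m n = trans
  (fromℚᵘ-cong {mkℚᵘ (+ (m ℕ.+ n)) d} {mkℚᵘ (+ m) d ℚᵘ.+ mkℚᵘ (+ n) d} (*≡* (cross (+ m) (+ n) (+ suc d))))
  (fromℚᵘ-homo-+ (mkℚᵘ (+ m) d) (mkℚᵘ (+ n) d))
  where
  cross : ∀ x y z → (x ℤ.+ y) ℤ.* (z ℤ.* z) ≡ (x ℤ.* z ℤ.+ y ℤ.* z) ℤ.* z
  cross = ℤ.solve-∀

÷≡fromℕ* : ∀ m d → m ÷ d ≡ fromℕ m * (1 ÷ d)
÷≡fromℕ* m zero    = sym (*-zeroʳ (fromℕ m))
÷≡fromℕ* m (suc d) = trans
  (fromℚᵘ-cong {mkℚᵘ (+ m) d} {mkℚᵘ (+ m) 0 ℚᵘ.* mkℚᵘ (+ 1) d} (*≡* (cross (+ m) (+ suc d))))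
  (fromℚᵘ-homo-* (mkℚᵘ (+ m) 0) (mkℚᵘ (+ 1) d))
  where
  cross : ∀ x z → x ℤ.* (ℤ.1ℤ ℤ.* z) ≡ x ℤ.* ℤ.1ℤ ℤ.* z
  cross = ℤ.solve-∀

n÷n≡1 : ∀ n .{{_ : NonZero n}} → n ÷ n ≡ 1ℚ
n÷n≡1 n@(suc d) = fromℚᵘ-cong {mkℚᵘ (+ n) d} {mkℚᵘ (+ 1) 0} (*≡* (ℤ.*-comm (+ n) (+ 1)))

-- The common shape of a mean number of zeros, `zeroCount` over a binomial coefficient, and of 2^n /
-- C(n,n/2) for even n.
[c+2s]÷c : ∀ c s .{{_ : NonZero c}} → (c ℕ.+ 2 ℕ.* s) ÷ c ≡ 1ℚ + (s ÷ c + s ÷ c)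
[c+2s]÷c c s = begin
  (c ℕ.+ 2 ℕ.* s) ÷ c           ≡⟨ ÷-distribʳ-+ c c (2 ℕ.* s) ⟩
  c ÷ c + (s ℕ.+ (s ℕ.+ 0)) ÷ c ≡⟨ cong₂ (λ x y → x + (s ℕ.+ y) ÷ c) (n÷n≡1 c) (ℕ.+-identityʳ s) ⟩
  1ℚ + (s ℕ.+ s) ÷ c            ≡⟨ cong (λ x → 1ℚ + x) (÷-distribʳ-+ c s s) ⟩
  1ℚ + (s ÷ c + s ÷ c)          ∎

-- Finite sums of rationals.

∑< : (ℕ → ℚ) → ℕ → ℚ
∑< f zero    = 0ℚ
∑< f (suc m) = ∑< f m + f m

∑<-front : ∀ f m → ∑< f (suc m) ≡ f 0 + ∑< (f ∘ suc) m
∑<-front f zero    = +-comm 0ℚ (f 0)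
∑<-front f (suc m) = trans (cong (_+ f (suc m)) (∑<-front f m)) (+-assoc (f 0) (∑< (f ∘ suc) m) (f (suc m)))

-- Turns the `Fin`-indexed sums of the theorem into sums over naturals, whose bounds can be
-- rewritten freely.
∑-toℕ : ∀ f m → ∑[ i < m ] f (toℕ i) ≡ ∑< f m
∑-toℕ f zero    = refl
∑-toℕ f (suc m) = trans (cong (λ s → f 0 + s) (∑-toℕ (f ∘ suc) m)) (sym (∑<-front f m))

∑<-cong : ∀ {f g} m → (∀ i → i < m → f i ≡ g i) → ∑< f m ≡ ∑< g m
∑<-cong zero    f≡g = refl
∑<-cong (suc m) f≡g = cong₂ _+_ (∑<-cong m λ i i<m → f≡g i (ℕ.m<n⇒m<1+n i<m)) (f≡g m ℕ.≤-refl)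

-- The indices from a to n are mirrored to those below b. Each step of the induction on b moves one
-- term across the cut, as f a = f b when a + b = n.
∑<-symmetric : ∀ {n f} → (∀ i j → i ℕ.+ j ≡ n → f i ≡ f j) →
               ∀ a b → a ℕ.+ b ≡ suc n → ∑< f (suc n) ≡ ∑< f a + ∑< f b
∑<-symmetric {n} {f} f-sym a zero    eq = begin
  ∑< f (suc n)     ≡⟨ cong (∑< f) (trans (sym eq) (ℕ.+-identityʳ a)) ⟩
  ∑< f a           ≡⟨ +-identityʳ (∑< f a) ⟨
  ∑< f a + 0ℚ      ∎
∑<-symmetric {n} {f} f-sym a (suc b) eq = begin
  ∑< f (suc n)               ≡⟨ ∑<-symmetric f-sym (suc a) b (trans (sym (ℕ.+-suc a b)) eq) ⟩
  ∑< f a + f a + ∑< f b      ≡⟨ +-assoc (∑< f a) (f a) (∑< f b) ⟩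
  ∑< f a + (f a + ∑< f b)    ≡⟨ cong (λ s → ∑< f a + s) (+-comm (f a) (∑< f b)) ⟩
  ∑< f a + (∑< f b + f a)    ≡⟨ cong (λ s → ∑< f a + (∑< f b + s)) (f-sym a b (ℕ.suc-injective (trans (sym (ℕ.+-suc a b)) eq))) ⟩
  ∑< f a + ∑< f (suc b)      ∎

∑<-C÷ : ∀ n c m → ∑< (λ k → (n C k) ÷ c) m ≡ ∑C n m ÷ c
∑<-C÷ n zero    zero    = refl
∑<-C÷ n (suc c) zero    = sym (0/n≡0 (suc c))
∑<-C÷ n c       (suc m) = trans (cong (_+ (n C m) ÷ c) (∑<-C÷ n c m)) (sym (÷-distribʳ-+ c (∑C n m) (n C m)))

∑<-1+double : ∀ f m → ∑< (λ i → 1ℚ + (f i + f i)) m ≡ fromℕ m + (∑< f m + ∑< f m)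
∑<-1+double f zero    = refl
∑<-1+double f (suc m) = begin
  ∑< (λ i → 1ℚ + (f i + f i)) m + (1ℚ + (f m + f m))
    ≡⟨ cong (_+ (1ℚ + (f m + f m))) (∑<-1+double f m) ⟩
  fromℕ m + (∑< f m + ∑< f m) + (1ℚ + (f m + f m))
    ≡⟨ regroup (fromℕ m) (∑< f m) 1ℚ (f m) ⟩
  1ℚ + fromℕ m + (∑< f m + f m + (∑< f m + f m))
    -- `fromℕ k` is k ÷ 1, so additivity of `_÷_` at divisor 1 gives fromℕ (suc m) = 1 + fromℕ m.
    ≡⟨ cong (_+ (∑< f m + f m + (∑< f m + f m))) (÷-distribʳ-+ 1 1 m) ⟨
  fromℕ (suc m) + (∑< f m + f m + (∑< f m + f m)) ∎
  where
  regroup : ∀ k s u x → k + (s + s) + (u + (x + x)) ≡ u + k + (s + x + (s + x))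
  regroup = solve 4 (λ k s u x → k :+ (s :+ s) :+ (u :+ (x :+ x)) := u :+ k :+ (s :+ x :+ (s :+ x))) refl
    where open +-*-Solver

-- Expectations over uniform and two-stage distributions.

total : {A : Set} → (A → ℚ) → List A → ℚ
total X xs = List.foldr _+_ 0ℚ (List.map X xs)

total-upTo : ∀ X m → total X (upTo m) ≡ ∑< X m
total-upTo X m = trans (cong (List.foldr _+_ 0ℚ) (map-upTo X m)) (go X m)
  where
  go : ∀ f m → List.foldr _+_ 0ℚ (applyUpTo f m) ≡ ∑< f m
  go f zero    = refl
  go f (suc m) = trans (cong (λ s → f 0 + s) (go (f ∘ suc) m)) (sym (∑<-front f m))

total-fromℕ : {A : Set} (f : A → ℕ) (xs : List A) → total (fromℕ ∘ f) xs ≡ fromℕ (sum (List.map f xs))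
total-fromℕ f []       = refl
total-fromℕ f (x ∷ xs) = trans (cong (λ s → fromℕ (f x) + s) (total-fromℕ f xs))
                               (sym (÷-distribʳ-+ 1 (f x) (sum (List.map f xs))))

module _ {A : Set} (X : A → ℚ) where

  𝔼-++ : (d e : Dist A) → 𝔼 (d ++ e) X ≡ 𝔼 d X + 𝔼 e X
  𝔼-++ []            e = sym (+-identityˡ (𝔼 e X))
  𝔼-++ ((a , p) ∷ d) e = trans (cong (λ s → p * X a + s) (𝔼-++ d e)) (sym (+-assoc (p * X a) (𝔼 d X) (𝔼 e X)))

  𝔼-scale : (p : ℚ) (d : Dist A) → 𝔼 (List.map (λ (a , q) → a , p * q) d) X ≡ p * 𝔼 d X
  𝔼-scale p []            = sym (*-zeroʳ p)
  𝔼-scale p ((a , q) ∷ d) = trans (cong₂ _+_ (*-assoc p q (X a)) (𝔼-scale p d)) (sym (*-distribˡ-+ p (q * X a) (𝔼 d X)))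

  -- The law of total expectation for a two-stage experiment.
  𝔼->>= : {B : Set} (d : Dist B) (f : B → Dist A) → 𝔼 (d >>= f) X ≡ 𝔼 d (λ b → 𝔼 (f b) X)
  𝔼->>= []            f = refl
  𝔼->>= ((b , p) ∷ d) f = trans (𝔼-++ (List.map (λ (a , q) → a , p * q) (f b)) (d >>= f))
                                (cong₂ _+_ (𝔼-scale p (f b)) (𝔼->>= d f))

  𝔼-equiprobable : (w : ℚ) (xs : List A) → 𝔼 (List.map (λ a → a , w) xs) X ≡ w * total X xs
  𝔼-equiprobable w []       = sym (*-zeroʳ w)
  𝔼-equiprobable w (x ∷ xs) = trans (cong (λ s → w * X x + s) (𝔼-equiprobable w xs))
                                    (sym (*-distribˡ-+ w (X x) (total X xs)))

  𝔼-uniform : (xs : List A) → 𝔼 (uniform xs) X ≡ 1 ÷ length xs * total X xs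
  𝔼-uniform []         = refl
  𝔼-uniform xs@(_ ∷ _) = 𝔼-equiprobable (1 ÷ length xs) xs

-- The mean number of zeros, for a fixed start height and for a random one.

𝔼-bridge : ∀ n h → 𝔼 (uniform (pathsFrom n h)) (fromℕ ∘ zeros) ≡ #zeros n h ÷ #bridges n h
𝔼-bridge n h = begin
  𝔼 (uniform (pathsFrom n h)) (fromℕ ∘ zeros)
    ≡⟨ 𝔼-uniform (fromℕ ∘ zeros) (pathsFrom n h) ⟩
  1 ÷ length (pathsFrom n h) * total (fromℕ ∘ zeros) (pathsFrom n h)
    ≡⟨ cong₂ (λ l s → 1 ÷ l * s)
         (trans (cong length (pathsFrom≡map-bridges n h)) (length-map (path h) (bridges n h)))
         (trans (total-fromℕ zeros (pathsFrom n h)) (cong (fromℕ ∘ sum)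
           (trans (cong (List.map zeros) (pathsFrom≡map-bridges n h)) (sym (map-∘ (bridges n h)))))) ⟩
  1 ÷ #bridges n h * fromℕ (#zeros n h)
    ≡⟨ *-comm (1 ÷ #bridges n h) (fromℕ (#zeros n h)) ⟩
  fromℕ (#zeros n h) * (1 ÷ #bridges n h)
    ≡⟨ ÷≡fromℕ* (#zeros n h) (#bridges n h) ⟨
  #zeros n h ÷ #bridges n h ∎

-- The start height with index i is that of the bridges with i down-steps and n - i up-steps, which
-- makes the closed forms applicable.
startHeight-⊖ : ∀ {n i} → i ≤ n → ℤ.- (+ n) ℤ.+ + (2 ℕ.* i) ≡ i ⊖ (n ∸ i)
startHeight-⊖ {n} {i} i≤n = begin
  ℤ.- (+ n) ℤ.+ + (2 ℕ.* i)        ≡⟨ ℤ.-m+n≡n⊖m n (2 ℕ.* i) ⟩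
  2 ℕ.* i ⊖ n                      ≡⟨ cong₂ (λ j m → i ℕ.+ j ⊖ m) (ℕ.+-identityʳ i) (sym (ℕ.m+[n∸m]≡n i≤n)) ⟩
  i ℕ.+ i ⊖ (i ℕ.+ (n ∸ i))        ≡⟨ ℤ.+-cancelˡ-⊖ i i (n ∸ i) ⟩
  i ⊖ (n ∸ i)                      ∎

-- For i ≤ n, half the mean number of zeros before the end point among paths with i down-steps.
excess : ℕ → ℕ → ℚ
excess n i = ∑C n (i ⊓ (n ∸ i)) ÷ (n C i)

𝔼-startHeight : ∀ {n i} → i ≤ n →
  𝔼 (uniform (pathsFrom n (ℤ.- (+ n) ℤ.+ + (2 ℕ.* i)))) (fromℕ ∘ zeros) ≡ 1ℚ + (excess n i + excess n i)
𝔼-startHeight {n} {i} i≤n = begin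
  𝔼 (uniform (pathsFrom n (ℤ.- (+ n) ℤ.+ + (2 ℕ.* i)))) (fromℕ ∘ zeros)
    ≡⟨ 𝔼-bridge n (ℤ.- (+ n) ℤ.+ + (2 ℕ.* i)) ⟩
  #zeros n (ℤ.- (+ n) ℤ.+ + (2 ℕ.* i)) ÷ #bridges n (ℤ.- (+ n) ℤ.+ + (2 ℕ.* i))
    ≡⟨ cong (λ h → #zeros n h ÷ #bridges n h) (startHeight-⊖ i≤n) ⟩
  #zeros n (i ⊖ (n ∸ i)) ÷ #bridges n (i ⊖ (n ∸ i))
    ≡⟨ cong₂ _÷_ (#zeros-⊖ n i (n ∸ i) (ℕ.m+[n∸m]≡n i≤n)) (#bridges-⊖ n i (n ∸ i) (ℕ.m+[n∸m]≡n i≤n)) ⟩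
  zeroCount n i (n ∸ i) ÷ (n C i)
    ≡⟨ [c+2s]÷c (n C i) (∑C n (i ⊓ (n ∸ i))) {{nCk≢0 i≤n}} ⟩
  1ℚ + (excess n i + excess n i) ∎

𝔼-randomPath : ∀ n → 𝔼 (randomPath n) (fromℕ ∘ zeros) ≡
               1ℚ + 1 ÷ suc n * (∑< (excess n) (suc n) + ∑< (excess n) (suc n))
𝔼-randomPath n = begin
  𝔼 (randomPath n) (fromℕ ∘ zeros)
    ≡⟨ 𝔼->>= (fromℕ ∘ zeros) (uniform (startHeights n)) (λ h → uniform (pathsFrom n h)) ⟩
  𝔼 (uniform (startHeights n)) mean
    ≡⟨ 𝔼-uniform mean (startHeights n) ⟩
  1 ÷ length (startHeights n) * total mean (startHeights n)
    ≡⟨ cong₂ (λ l s → 1 ÷ l * List.foldr _+_ 0ℚ s)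
         (trans (length-map height (upTo (suc n))) (length-upTo (suc n)))
         (sym (map-∘ {g = mean} {f = height} (upTo (suc n)))) ⟩
  1 ÷ suc n * total (mean ∘ height) (upTo (suc n))
    ≡⟨ cong (λ s → 1 ÷ suc n * s) (total-upTo (mean ∘ height) (suc n)) ⟩
  1 ÷ suc n * ∑< (mean ∘ height) (suc n)
    ≡⟨ cong (λ s → 1 ÷ suc n * s) (∑<-cong (suc n) λ i i<1+n → 𝔼-startHeight (s≤s⁻¹ i<1+n)) ⟩
  1 ÷ suc n * ∑< (λ i → 1ℚ + (excess n i + excess n i)) (suc n)
    ≡⟨ cong (λ s → 1 ÷ suc n * s) (∑<-1+double (excess n) (suc n)) ⟩
  1 ÷ suc n * (fromℕ (suc n) + (∑< (excess n) (suc n) + ∑< (excess n) (suc n)))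
    ≡⟨ *-distribˡ-+ (1 ÷ suc n) (fromℕ (suc n)) (∑< (excess n) (suc n) + ∑< (excess n) (suc n)) ⟩
  1 ÷ suc n * fromℕ (suc n) + 1 ÷ suc n * (∑< (excess n) (suc n) + ∑< (excess n) (suc n))
    ≡⟨ cong (_+ 1 ÷ suc n * (∑< (excess n) (suc n) + ∑< (excess n) (suc n)))
         (trans (*-comm (1 ÷ suc n) (fromℕ (suc n))) (trans (sym (÷≡fromℕ* (suc n) (suc n))) (n÷n≡1 (suc n)))) ⟩
  1ℚ + 1 ÷ suc n * (∑< (excess n) (suc n) + ∑< (excess n) (suc n)) ∎
  where
  height : ℕ → ℤ.ℤ
  height i = ℤ.- (+ n) ℤ.+ + (2 ℕ.* i)

  mean : ℤ.ℤ → ℚ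
  mean h = 𝔼 (uniform (pathsFrom n h)) (fromℕ ∘ zeros)

-- Folding the sum over start heights.

excess-sym : ∀ n i j → i ℕ.+ j ≡ n → excess n i ≡ excess n j
excess-sym n i j refl = cong₂ (λ s c → ∑C n s ÷ c)
  (begin
    i ⊓ (i ℕ.+ j ∸ i)  ≡⟨ cong (i ⊓_) (ℕ.m+n∸m≡n i j) ⟩
    i ⊓ j              ≡⟨ ℕ.⊓-comm i j ⟩
    j ⊓ i              ≡⟨ cong (j ⊓_) (ℕ.m+n∸n≡m i j) ⟨
    j ⊓ (i ℕ.+ j ∸ j)  ∎)
  ([a+b]Ca≡[a+b]Cb i j)

-- The inner sum of the theorem, over k < ℓ, as a single fraction.
∑C÷C : ℕ → ℕ → ℚ
∑C÷C n ℓ = ∑C n ℓ ÷ (n C ℓ)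

excess≡∑C÷C : ∀ n i → i ≤ ⌊ n /2⌋ → excess n i ≡ ∑C÷C n i
excess≡∑C÷C n i i≤⌊n/2⌋ = cong (λ s → ∑C n s ÷ (n C i)) (ℕ.m≤n⇒m⊓n≡m (ℕ.m+n≤o⇒m≤o∸n i i+i≤n))
  where
  i+i≤n : i ℕ.+ i ≤ n
  i+i≤n = ℕ.≤-trans (ℕ.+-mono-≤ i≤⌊n/2⌋ (ℕ.≤-trans i≤⌊n/2⌋ (ℕ.⌊n/2⌋≤⌈n/2⌉ n)))
                    (ℕ.≤-reflexive (ℕ.⌊n/2⌋+⌈n/2⌉≡n n))

⌈n/2⌉≤1+⌊n/2⌋ : ∀ n → ⌈ n /2⌉ ≤ suc ⌊ n /2⌋
-- By definition the two sides are ⌊(n+1)/2⌋ and ⌊(n+2)/2⌋.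
⌈n/2⌉≤1+⌊n/2⌋ n = ℕ.⌊n/2⌋-mono {suc n} {suc (suc n)} (ℕ.n≤1+n (suc n))

-- The n + 1 indices are cut into ⌈n/2⌉ lower ones and ⌊n/2⌋ + 1 upper ones. After mirroring, all
-- lie in the lower half, where i is the smaller of i and n - i. The second part contains the
-- unpaired middle index when n is even.
∑-excess : ∀ n → ∑< (excess n) (suc n) ≡ ∑< (∑C÷C n) ⌈ n /2⌉ + ∑< (∑C÷C n) (suc ⌊ n /2⌋)
∑-excess n = trans
  (∑<-symmetric (excess-sym n) ⌈ n /2⌉ (suc ⌊ n /2⌋)
    (trans (ℕ.+-comm ⌈ n /2⌉ (suc ⌊ n /2⌋)) (cong suc (ℕ.⌊n/2⌋+⌈n/2⌉≡n n))))
  (cong₂ _+_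
    (∑<-cong ⌈ n /2⌉ λ i i<⌈n/2⌉ → excess≡∑C÷C n i (s≤s⁻¹ (ℕ.≤-trans i<⌈n/2⌉ (⌈n/2⌉≤1+⌊n/2⌋ n))))
    (∑<-cong (suc ⌊ n /2⌋) λ i i<1+⌊n/2⌋ → excess≡∑C÷C n i (s≤s⁻¹ i<1+⌊n/2⌋)))

-- The double sum and the parity term of the closed form.

∑∑-C/C : ∀ n → ∑[ ℓ < ⌈ n /2⌉ ] (∑[ k < toℕ ℓ ] (+ (n C toℕ k) / (n C toℕ ℓ)) {{nCℓ≢0 n ℓ}}) ≡ ∑< (∑C÷C n) ⌈ n /2⌉
∑∑-C/C n = trans
  (sum-cong-≗ {⌈ n /2⌉} λ ℓ → begin
    ∑[ k < toℕ ℓ ] (+ (n C toℕ k) / (n C toℕ ℓ)) {{nCℓ≢0 n ℓ}}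
      ≡⟨ sum-cong-≗ {toℕ ℓ} (λ k → /≡÷ (n C toℕ k) (n C toℕ ℓ) {{nCℓ≢0 n ℓ}}) ⟩
    ∑[ k < toℕ ℓ ] ((n C toℕ k) ÷ (n C toℕ ℓ))
      ≡⟨ ∑-toℕ (λ k → (n C k) ÷ (n C toℕ ℓ)) (toℕ ℓ) ⟩
    ∑< (λ k → (n C k) ÷ (n C toℕ ℓ)) (toℕ ℓ)
      ≡⟨ ∑<-C÷ n (n C toℕ ℓ) (toℕ ℓ) ⟩
    ∑C÷C n (toℕ ℓ) ∎)
  (∑-toℕ (∑C÷C n) ⌈ n /2⌉)

-- Ties the evenness test of the Iverson bracket to the lengths of the two parts of the folded sum.
parity : ∀ n → (2 ∣ n × ⌈ n /2⌉ ≡ ⌊ n /2⌋) ⊎ (¬ 2 ∣ n × ⌈ n /2⌉ ≡ suc ⌊ n /2⌋)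
parity zero          = inj₁ (2 ∣0 , refl)
parity (suc zero)    = inj₂ (>⇒∤ ℕ.≤-refl , refl)
parity (suc (suc n)) with parity n
... | inj₁ (2∣n , eq) = inj₁ (∣m∣n⇒∣m+n ∣-refl 2∣n , cong suc eq)
... | inj₂ (2∤n , eq) = inj₂ ((λ 2∣2+n → 2∤n (∣m+n∣m⇒∣n 2∣2+n ∣-refl)) , cong suc eq)

[[]]≡1 : {P : Set} (P? : Dec P) → P → [[ P? ]] ≡ 1ℚ
[[]]≡1 P? p = cong (λ b → if b then 1ℚ else 0ℚ) (dec-true P? p)

[[]]≡0 : {P : Set} (P? : Dec P) → ¬ P → [[ P? ]] ≡ 0ℚ
[[]]≡0 P? ¬p = cong (λ b → if b then 1ℚ else 0ℚ) (dec-false P? ¬p)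

2^n/C : ∀ n → ⌈ n /2⌉ ≡ ⌊ n /2⌋ →
        (+ (2 ^ n) / (n C ⌊ n /2⌋)) {{nC⌊n/2⌋≢0 n}} ≡ 1ℚ + (∑C÷C n ⌊ n /2⌋ + ∑C÷C n ⌊ n /2⌋)
2^n/C n even = begin
  (+ (2 ^ n) / c) {{c≢0}}      ≡⟨ /≡÷ (2 ^ n) c {{c≢0}} ⟩
  -- `∑C-complement` is taken at m and m + 1, where `∑C n (suc m)` unfolds to s + c, so that C(n,m)
  -- is counted once and every smaller index twice.
  2 ^ n ÷ c                    ≡⟨ cong (_÷ c) (∑C-complement n m (suc m) m+1+m≡1+n) ⟨
  (s ℕ.+ (s ℕ.+ c)) ÷ c        ≡⟨ cong (_÷ c) (regroup s c) ⟩
  (c ℕ.+ 2 ℕ.* s) ÷ c          ≡⟨ [c+2s]÷c c s {{c≢0}} ⟩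
  1ℚ + (s ÷ c + s ÷ c)         ∎
  where
  m = ⌊ n /2⌋
  c = n C m
  s = ∑C n m
  c≢0 = nC⌊n/2⌋≢0 n

  m+1+m≡1+n : m ℕ.+ suc m ≡ suc n
  m+1+m≡1+n = trans (ℕ.+-suc m m) (cong suc (trans (cong (m ℕ.+_) (sym even)) (ℕ.⌊n/2⌋+⌈n/2⌉≡n n)))

  regroup : ∀ s c → s ℕ.+ (s ℕ.+ c) ≡ c ℕ.+ 2 ℕ.* s
  regroup = ℕ.solve-∀

theoremA1 : (n : ℕ) →
    𝔼 (randomPath n) (λ P → fromℕ (zeros P))
    ≡ (+ 4 / suc n) * (∑[ ℓ < ⌈ n /2⌉ ] (∑[ k < toℕ ℓ ] (+ (n C toℕ k) / (n C toℕ ℓ)) {{nCℓ≢0 n ℓ}}))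
    + [[ 2 ∣? n ]] * ((+ 1 / suc n) * ((+ (2 ^ n) / (n C ⌊ n /2⌋)) {{nC⌊n/2⌋≢0 n}} - 1ℚ))
    + 1ℚ
theoremA1 n = begin
  𝔼 (randomPath n) (fromℕ ∘ zeros)
    ≡⟨ 𝔼-randomPath n ⟩
  1ℚ + w * (∑< (excess n) (suc n) + ∑< (excess n) (suc n))
    ≡⟨ cong (λ t → 1ℚ + w * (t + t)) (∑-excess n) ⟩
  1ℚ + w * ((s + s′) + (s + s′))
    -- The factor 4 combines the 2 in front of each excess with the 2 from folding.
    ≡⟨ by-parity (parity n) ⟩
  fromℕ 4 * w * s + [[ 2 ∣? n ]] * (w * (y - 1ℚ)) + 1ℚ
    ≡⟨ cong₂ (λ q t → q * t + [[ 2 ∣? n ]] * (w * (y - 1ℚ)) + 1ℚ) (÷≡fromℕ* 4 (suc n)) (∑∑-C/C n) ⟨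
  (+ 4 / suc n) * (∑[ ℓ < ⌈ n /2⌉ ] (∑[ k < toℕ ℓ ] (+ (n C toℕ k) / (n C toℕ ℓ)) {{nCℓ≢0 n ℓ}}))
    + [[ 2 ∣? n ]] * (w * (y - 1ℚ)) + 1ℚ ∎
  where
  w s s′ r y : ℚ
  w  = 1 ÷ suc n
  s  = ∑< (∑C÷C n) ⌈ n /2⌉
  s′ = ∑< (∑C÷C n) (suc ⌊ n /2⌋)
  r  = ∑C÷C n ⌊ n /2⌋
  y  = (+ (2 ^ n) / (n C ⌊ n /2⌋)) {{nC⌊n/2⌋≢0 n}}

  open +-*-Solver

  -- `1ℚ + (r + r)` is the value of y for even n: the middle index contributes w * (r + r) = w * (y
  -- - 1).
  evenIdentity : ∀ w s r → 1ℚ + w * ((s + (s + r)) + (s + (s + r)))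
                 ≡ fromℕ 4 * w * s + 1ℚ * (w * (1ℚ + (r + r) - 1ℚ)) + 1ℚ
  evenIdentity = solve 3 (λ w s r →
    con 1ℚ :+ w :* ((s :+ (s :+ r)) :+ (s :+ (s :+ r)))
    := con (fromℕ 4) :* w :* s :+ con 1ℚ :* (w :* (con 1ℚ :+ (r :+ r) :- con 1ℚ)) :+ con 1ℚ) refl

  oddIdentity : ∀ w s y → 1ℚ + w * ((s + s) + (s + s)) ≡ fromℕ 4 * w * s + 0ℚ * (w * (y - 1ℚ)) + 1ℚ
  oddIdentity = solve 3 (λ w s y →
    con 1ℚ :+ w :* ((s :+ s) :+ (s :+ s))
    := con (fromℕ 4) :* w :* s :+ con 0ℚ :* (w :* (y :- con 1ℚ)) :+ con 1ℚ) refl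

  by-parity : (2 ∣ n × ⌈ n /2⌉ ≡ ⌊ n /2⌋) ⊎ (¬ 2 ∣ n × ⌈ n /2⌉ ≡ suc ⌊ n /2⌋) →
              1ℚ + w * ((s + s′) + (s + s′)) ≡ fromℕ 4 * w * s + [[ 2 ∣? n ]] * (w * (y - 1ℚ)) + 1ℚ
  by-parity (inj₁ (2∣n , even)) = begin
    1ℚ + w * ((s + s′) + (s + s′))
      -- s′ unfolds to the sum up to ⌊n/2⌋ plus its last term r; evenness identifies that shorter
      -- sum with s.
      ≡⟨ cong (λ t → 1ℚ + w * ((s + (t + r)) + (s + (t + r)))) (cong (∑< (∑C÷C n)) even) ⟨
    1ℚ + w * ((s + (s + r)) + (s + (s + r)))
      ≡⟨ evenIdentity w s r ⟩
    fromℕ 4 * w * s + 1ℚ * (w * (1ℚ + (r + r) - 1ℚ)) + 1ℚ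
      ≡⟨ cong₂ (λ b z → fromℕ 4 * w * s + b * (w * (z - 1ℚ)) + 1ℚ) ([[]]≡1 (2 ∣? n) 2∣n) (2^n/C n even) ⟨
    fromℕ 4 * w * s + [[ 2 ∣? n ]] * (w * (y - 1ℚ)) + 1ℚ ∎
  by-parity (inj₂ (2∤n , odd)) = begin
    1ℚ + w * ((s + s′) + (s + s′))
      -- For odd n both sums have the same bound, so s′ equals s.
      ≡⟨ cong (λ t → 1ℚ + w * ((s + t) + (s + t))) (cong (∑< (∑C÷C n)) odd) ⟨
    1ℚ + w * ((s + s) + (s + s))
      ≡⟨ oddIdentity w s y ⟩
    fromℕ 4 * w * s + 0ℚ * (w * (y - 1ℚ)) + 1ℚ
      ≡⟨ cong (λ b → fromℕ 4 * w * s + b * (w * (y - 1ℚ)) + 1ℚ) ([[]]≡0 (2 ∣? n) 2∤n) ⟨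
    fromℕ 4 * w * s + [[ 2 ∣? n ]] * (w * (y - 1ℚ)) + 1ℚ ∎
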